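{- There is a countable set $A_0\subseteq 2^\omega$ such that for every $A$ with $A_0\subseteq A\subseteq 2^\omega$ and $2^\omega\setminus A$ dense, the quantifier $Q_A$ is not $\Sigma^1_1$-definable, i.e. the class $K_A$ of all $\tau_d$-structures $\mathcal M$ such that $\Omega(\mathcal M)\setminus A$ is dense is not the class of models of any $\Sigma^1_1$ sentence.
   Context: Let $\tau_d=\{R_0,R_1,R_2,R_3,R_4\}$ with $R_0,R_1,R_2$ binary and $R_3,R_4$ unary. For $n<\omega$ and $\eta\in 2^n$ let $\psi_\eta(x)$ be the first-order formula $R_4(x)\wedge\exists y_0\ldots\exists y_n\big(R_3(y_0)\wedge R_4(y_n)\wedge\bigwedge_{i<n}R_{\eta(i)}(y_i,y_{i+1})\wedge\bigwedge_{i\le n}R_2(y_i,x)\big)$. For a $\tau_d$-structure $\mathcal M$ and $a\in M$ let $\Omega(\mathcal M,a)=\{\eta\in 2^{<\omega}:\mathcal M\models\psi_\eta(a)\}$ and $\Omega(\mathcal M)=\{\eta\in 2^\omega:\exists a\in M\ \forall n<\omega\ \eta\restriction n\in\Omega(\mathcal M,a)\}$. A set $B\subseteq 2^\omega$ is dense if every $s\in 2^{<\omega}$ has an extension in $B$. $\Sigma^1_1$ sentences are those of the form $\exists R_1\ldots\exists R_m\varphi$ with $\varphi$ first-order. -}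

module Defs where

open import Level using (0ℓ) renaming (suc to lsuc)
open import Data.Nat using (ℕ; zero; suc; _<_; _≤_)
open import Data.Fin using (Fin) renaming (zero to fz; suc to fs)
open import Data.Bool using (Bool; true; false)
open import Data.List using (List; []; _∷_)
open import Data.List.Membership.Propositional using (_∈_)
open import Data.List.Relation.Unary.All using (All) renaming (lookup to allLookup)
open import Data.Vec using (Vec) renaming (map to vmap)
open import Data.Product using (Σ; _×_; _,_; ∃)
open import Data.Sum using (_⊎_)
open import Data.Empty using (⊥)
open import Data.Unit using (⊤)
open import Relation.Nullary using (¬_)
open import Relation.Binary.PropositionalEquality using (_≡_)

2^ω : Set
2^ω = ℕ → Bool

_⊑_ : List Bool → 2^ω → Set
[] ⊑ η = ⊤
(b ∷ s) ⊑ η = (η 0 ≡ b) × (s ⊑ (λ n → η (suc n)))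

Dense : (2^ω → Set) → Set
Dense B = (s : List Bool) → Σ 2^ω (λ η → (s ⊑ η) × B η)

-- A predicate on 2^ω that is a genuine subset (respects equality of sequences)
Extensional : (2^ω → Set) → Set
Extensional A = (η η' : 2^ω) → ((n : ℕ) → η n ≡ η' n) → A η → A η'

record Str : Set₁ where
  field
    M  : Set
    R0 R1 R2 : M → M → Set
    R3 R4 : M → Set

open Str public

Rb : (𝓜 : Str) → Bool → M 𝓜 → M 𝓜 → Set
Rb 𝓜 false = R0 𝓜
Rb 𝓜 true  = R1 𝓜

-- 𝓜 ⊨ ψ_{η↾n}(a)   (semantics of ψ_η written out; y_0..y_n given by y)
ψ : (𝓜 : Str) (n : ℕ) (η : 2^ω) → M 𝓜 → Set
ψ 𝓜 n η a =
  R4 𝓜 a ×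
  Σ (ℕ → M 𝓜) (λ y →
      R3 𝓜 (y 0) × R4 𝓜 (y n)
    × ((i : ℕ) → i < n → Rb 𝓜 (η i) (y i) (y (suc i)))
    × ((i : ℕ) → i ≤ n → R2 𝓜 (y i) a))

Ω : (𝓜 : Str) → 2^ω → Set
Ω 𝓜 η = Σ (M 𝓜) (λ a → (n : ℕ) → ψ 𝓜 n η a)

K : (2^ω → Set) → Str → Set
K A 𝓜 = Dense (λ η → Ω 𝓜 η × ¬ A η)

-- First-order formulas over τ_d ∪ {extra relation symbols with given arities},
-- with equality; k = number of free variables (de Bruijn, Fin k).

data Formula (ar : List ℕ) (k : ℕ) : Set where
  r0 r1 r2 : Fin k → Fin k → Formula ar k
  r3 r4    : Fin k → Formula ar k
  eq       : Fin k → Fin k → Formula ar k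
  rel      : {m : ℕ} → m ∈ ar → Vec (Fin k) m → Formula ar k
  fals     : Formula ar k
  neg      : Formula ar k → Formula ar k
  and or imp : Formula ar k → Formula ar k → Formula ar k
  ex all   : Formula ar (suc k) → Formula ar k

Interp : Set → List ℕ → Set₁
Interp D ar = All (λ m → Vec D m → Set) ar

extend : {D : Set} {k : ℕ} → (Fin k → D) → D → Fin (suc k) → D
extend ρ d fz = d
extend ρ d (fs i) = ρ i

Sat : (𝓜 : Str) {ar : List ℕ} → Interp (M 𝓜) ar → {k : ℕ} →
      Formula ar k → (Fin k → M 𝓜) → Set
Sat 𝓜 I (r0 i j) ρ = R0 𝓜 (ρ i) (ρ j)
Sat 𝓜 I (r1 i j) ρ = R1 𝓜 (ρ i) (ρ j)
Sat 𝓜 I (r2 i j) ρ = R2 𝓜 (ρ i) (ρ j)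
Sat 𝓜 I (r3 i) ρ = R3 𝓜 (ρ i)
Sat 𝓜 I (r4 i) ρ = R4 𝓜 (ρ i)
Sat 𝓜 I (eq i j) ρ = ρ i ≡ ρ j
Sat 𝓜 I (rel p v) ρ = allLookup I p (vmap ρ v)
Sat 𝓜 I fals ρ = ⊥
Sat 𝓜 I (neg φ) ρ = ¬ Sat 𝓜 I φ ρ
Sat 𝓜 I (and φ χ) ρ = Sat 𝓜 I φ ρ × Sat 𝓜 I χ ρ
Sat 𝓜 I (or φ χ) ρ = Sat 𝓜 I φ ρ ⊎ Sat 𝓜 I χ ρ
Sat 𝓜 I (imp φ χ) ρ = Sat 𝓜 I φ ρ → Sat 𝓜 I χ ρ
Sat 𝓜 I (ex φ) ρ = Σ (M 𝓜) (λ d → Sat 𝓜 I φ (extend ρ d))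
Sat 𝓜 I (all φ) ρ = (d : M 𝓜) → Sat 𝓜 I φ (extend ρ d)

-- Σ^1_1 sentences  ∃R_1 … ∃R_m φ  (φ first-order sentence in τ_d ∪ {R_1..R_m})

record Σ¹₁ : Set where
  field
    arities : List ℕ
    body    : Formula arities 0

noVars : {D : Set} → Fin 0 → D
noVars ()

_⊨_ : Str → Σ¹₁ → Set₁
𝓜 ⊨ φ = Σ (Interp (M 𝓜) (Σ¹₁.arities φ))
           (λ I → Sat 𝓜 I (Σ¹₁.body φ) noVars)

{-# OPTIONS --safe #-}

-- Every logic with countably many sentences fails to define Q_A, for one and the
-- same reason.  For each sentence φ having a model 𝓜 with Ω(𝓜) countable, fix one
-- such model and put Ω(𝓜) into A₀.  If φ defined K_A, a countable dense subset B
-- of the complement of A would give a structure in K_A with Ω = B, so φ has a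
-- model of this kind; but the fixed one has Ω ⊆ A₀ ⊆ A, hence is not in K_A.

module Submission where

open import Defs
open import Level using (0ℓ; Lift; lift; lower) renaming (suc to lsuc)
open import Data.Bool using (Bool; true; false)
open import Data.Fin using (Fin; toℕ)
open import Data.Fin.Properties as Fin using (toℕ-injective)
open import Data.List using (List; []; _∷_)
open import Data.List.Membership.Propositional using (_∈_)
open import Data.List.Relation.Unary.Any using (here; there; index)
open import Data.Nat using (ℕ; zero; suc; _+_; _≤_)
open import Data.Nat.Properties using (+-suc; +-identityʳ; suc-injective; ≤-refl; <⇒≤)
open import Data.Product using (Σ; ∃; _×_; _,_; proj₁; proj₂)
open import Data.Product.Properties using (,-injectiveˡ; ,-injectiveʳ)
open import Data.Unit using (⊤; tt)
open import Data.Vec using (Vec; []; _∷_)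
open import Function using (id; _∘_)
open import Function.Definitions using (Injective; StrictlySurjective)
open import Relation.Nullary using (¬_; Dec; yes; no; contradiction)
open import Relation.Nullary.Decidable using (map′)
open import Relation.Binary.PropositionalEquality
  using (_≡_; refl; sym; trans; cong; cong₂; subst)
open import Axiom.ExcludedMiddle using (ExcludedMiddle)

-- unpair walks the diagonals of ℕ × ℕ; pair a b is the time at which it visits (a , b).

next : ℕ × ℕ → ℕ × ℕ
next (zero  , b) = suc b , zero
next (suc a , b) = a , suc b

unpair : ℕ → ℕ × ℕ
unpair zero    = zero , zero
unpair (suc n) = next (unpair n)

triangular : ℕ → ℕ
triangular zero    = zero
triangular (suc n) = suc (n + triangular n)

pair : ℕ → ℕ → ℕ
pair a b = b + triangular (a + b)

-- Along a diagonal each `next` moves one unit from the first coordinate to the second.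
unpair-diagonal : ∀ {n} a b → unpair n ≡ (a + b , 0) → unpair (b + n) ≡ (a , b)
unpair-diagonal a zero    h = trans h (cong (_, 0) (+-identityʳ a))
unpair-diagonal a (suc b) h =
  cong next (unpair-diagonal (suc a) b (trans h (cong (_, 0) (+-suc a b))))

unpair-triangular : ∀ n → unpair (triangular n) ≡ (n , 0)
unpair-triangular zero    = refl
unpair-triangular (suc n) = cong next (unpair-diagonal 0 n (unpair-triangular n))

unpair-pair : ∀ a b → unpair (pair a b) ≡ (a , b)
unpair-pair a b = unpair-diagonal a b (unpair-triangular (a + b))

pair-injective : ∀ {a b a′ b′} → pair a b ≡ pair a′ b′ → a ≡ a′ × b ≡ b′
pair-injective {a} {b} {a′} {b′} h = ,-injectiveˡ h′ , ,-injectiveʳ h′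
  where
  h′ : (a , b) ≡ (a′ , b′)
  h′ = trans (sym (unpair-pair a b)) (trans (cong unpair h) (unpair-pair a′ b′))

codeBool : Bool → ℕ
codeBool false = 0
codeBool true  = 1

codeBool-injective : Injective _≡_ _≡_ codeBool
codeBool-injective {false} {false} _ = refl
codeBool-injective {true}  {true}  _ = refl

codeList : {X : Set} → (X → ℕ) → List X → ℕ
codeList f []       = 0
codeList f (x ∷ xs) = suc (pair (f x) (codeList f xs))

codeList-injective : {X : Set} {f : X → ℕ} →
  Injective _≡_ _≡_ f → Injective _≡_ _≡_ (codeList f)
codeList-injective f-inj {[]}    {[]}    _  = refl
codeList-injective f-inj {_ ∷ _} {_ ∷ _} h with pair-injective (suc-injective h)
... | p , q = cong₂ _∷_ (f-inj p) (codeList-injective f-inj q)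

-- The type fixes the length, so, unlike in `codeList`, nil and cons may share a code.
codeVec : ∀ {k m} → Vec (Fin k) m → ℕ
codeVec []       = 0
codeVec (i ∷ is) = pair (toℕ i) (codeVec is)

codeVec-injective : ∀ {k m} → Injective _≡_ _≡_ (codeVec {k} {m})
codeVec-injective {x = []}    {y = []}    _  = refl
codeVec-injective {x = _ ∷ _} {y = _ ∷ _} h with pair-injective h
... | p , q = cong₂ _∷_ (toℕ-injective p) (codeVec-injective q)

-- The conclusion equates pairs because `x` and `y` may differ a priori. For `rel` this recovers the
-- implicit arity before the argument vectors are compared.
index-injective : {X : Set} {x y : X} {xs : List X} (p : x ∈ xs) (q : y ∈ xs) →
  index p ≡ index q → _≡_ {A = ∃ (_∈ xs)} (x , p) (y , q)
index-injective (here refl) (here refl) _    = refl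
index-injective (there p)   (there q)   h
  with refl ← index-injective p q (Fin.suc-injective h) = refl

tag : ∀ {ar k} → Formula ar k → ℕ
tag (r0 _ _)  = 0
tag (r1 _ _)  = 1
tag (r2 _ _)  = 2
tag (r3 _)    = 3
tag (r4 _)    = 4
tag (eq _ _)  = 5
tag (rel _ _) = 6
tag fals      = 7
tag (neg _)   = 8
tag (and _ _) = 9
tag (or _ _)  = 10
tag (imp _ _) = 11
tag (ex _)    = 12
tag (all _)   = 13

codeFormula : ∀ {ar k} → Formula ar k → ℕ
payload     : ∀ {ar k} → Formula ar k → ℕ

codeFormula φ = pair (tag φ) (payload φ)

payload (r0 i j)  = pair (toℕ i) (toℕ j)
payload (r1 i j)  = pair (toℕ i) (toℕ j)
payload (r2 i j)  = pair (toℕ i) (toℕ j)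
payload (r3 i)    = toℕ i
payload (r4 i)    = toℕ i
payload (eq i j)  = pair (toℕ i) (toℕ j)
payload (rel p v) = pair (toℕ (index p)) (codeVec v)
payload fals      = 0
payload (neg φ)   = codeFormula φ
payload (and φ χ) = pair (codeFormula φ) (codeFormula χ)
payload (or φ χ)  = pair (codeFormula φ) (codeFormula χ)
payload (imp φ χ) = pair (codeFormula φ) (codeFormula χ)
payload (ex φ)    = codeFormula φ
payload (all φ)   = codeFormula φ

pair-cong-injective : {X Y Z : Set} {f : X → ℕ} {g : Y → ℕ} (c : X → Y → Z) →
  ∀ {x x′ y y′} → (f x ≡ f x′ → x ≡ x′) → (g y ≡ g y′ → y ≡ y′) →
  pair (f x) (g y) ≡ pair (f x′) (g y′) → c x y ≡ c x′ y′
pair-cong-injective c f-inj g-inj h with pair-injective h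
... | p , q = cong₂ c (f-inj p) (g-inj q)

mutual
  codeFormula-injective : ∀ {ar k} (φ χ : Formula ar k) →
    codeFormula φ ≡ codeFormula χ → φ ≡ χ
  codeFormula-injective φ χ h with pair-injective h
  ... | p , q = payload-injective φ χ p q

  -- Equal tags rule out distinct constructors, which leaves one case per constructor.
  payload-injective : ∀ {ar k} (φ χ : Formula ar k) →
    tag φ ≡ tag χ → payload φ ≡ payload χ → φ ≡ χ
  payload-injective (r0 _ _) (r0 _ _) refl = pair-cong-injective r0 toℕ-injective toℕ-injective
  payload-injective (r1 _ _) (r1 _ _) refl = pair-cong-injective r1 toℕ-injective toℕ-injective
  payload-injective (r2 _ _) (r2 _ _) refl = pair-cong-injective r2 toℕ-injective toℕ-injective
  payload-injective (r3 _)   (r3 _)   refl = cong r3 ∘ toℕ-injective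
  payload-injective (r4 _)   (r4 _)   refl = cong r4 ∘ toℕ-injective
  payload-injective (eq _ _) (eq _ _) refl = pair-cong-injective eq toℕ-injective toℕ-injective
  payload-injective (rel p v) (rel q w) refl e
    with e₁ , e₂ ← pair-injective e
    with refl ← index-injective p q (toℕ-injective e₁) = cong (rel p) (codeVec-injective e₂)
  payload-injective fals      fals        refl = λ _ → refl
  payload-injective (neg φ)   (neg φ′)    refl = cong neg ∘ codeFormula-injective φ φ′
  payload-injective (and φ χ) (and φ′ χ′) refl =
    pair-cong-injective and (codeFormula-injective φ φ′) (codeFormula-injective χ χ′)
  payload-injective (or φ χ)  (or φ′ χ′)  refl =
    pair-cong-injective or (codeFormula-injective φ φ′) (codeFormula-injective χ χ′)
  payload-injective (imp φ χ) (imp φ′ χ′) refl =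
    pair-cong-injective imp (codeFormula-injective φ φ′) (codeFormula-injective χ χ′)
  payload-injective (ex φ)    (ex φ′)     refl = cong ex ∘ codeFormula-injective φ φ′
  payload-injective (all φ)   (all φ′)    refl = cong all ∘ codeFormula-injective φ φ′

codeSentence : Σ¹₁ → ℕ
codeSentence φ = pair (codeList id (Σ¹₁.arities φ)) (codeFormula (Σ¹₁.body φ))

codeSentence-injective : Injective _≡_ _≡_ codeSentence
codeSentence-injective {φ} {χ} h with pair-injective h
-- The type of the body depends on the arities, so these are identified first.
... | p , q with refl ← codeList-injective {f = id} id {Σ¹₁.arities φ} {Σ¹₁.arities χ} p
  = cong (λ β → record { arities = _ ; body = β })
      (codeFormula-injective (Σ¹₁.body φ) (Σ¹₁.body χ) q)

-- Excluded middle decides which numbers are codes; all others are sent to `default`.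
enumerate : ExcludedMiddle (lsuc 0ℓ) → {X : Set} → X → {code : X → ℕ} →
  Injective _≡_ _≡_ code → Σ (ℕ → X) (StrictlySurjective _≡_)
enumerate em {X} default {code} code-inj = enum , λ x → code x , enum-code x
  where
  preimage? : ∀ n → Dec (∃ λ x → code x ≡ n)
  preimage? n = map′ lower lift (em {Lift (lsuc 0ℓ) (∃ λ x → code x ≡ n)})

  enum : ℕ → X
  enum n with preimage? n
  ... | yes (x , _) = x
  ... | no _        = default

  enum-code : ∀ x → enum (code x) ≡ x
  enum-code x with preimage? (code x)
  ... | yes (_ , h) = code-inj h
  ... | no ∄        = contradiction (x , refl) ∄

-- The disjoint union of the paths e s; a node of the path e s is related by R2
-- to all nodes of that path, so that each of them realises exactly e s.
module _ (e : List Bool → 2^ω) where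

  Edge : Bool → List Bool × ℕ → List Bool × ℕ → Set
  Edge b (s , i) (t , j) = s ≡ t × j ≡ suc i × e s i ≡ b

  pathStr : Str
  pathStr = record
    { M  = List Bool × ℕ
    ; R0 = Edge false
    ; R1 = Edge true
    ; R2 = λ (s , _) (t , _) → s ≡ t
    ; R3 = λ (_ , i) → i ≡ 0
    ; R4 = λ _ → ⊤
    }

  -- `Rb` matches on its Boolean, so the two relations agree by computation only after a case split.
  Edge⇒Rb : ∀ b {x y} → Edge b x y → Rb pathStr b x y
  Edge⇒Rb false = id
  Edge⇒Rb true  = id

  Rb⇒Edge : ∀ b {x y} → Rb pathStr b x y → Edge b x y
  Rb⇒Edge false = id
  Rb⇒Edge true  = id

  path-Ω : ∀ s → Ω pathStr (e s)
  path-Ω s = (s , 0) , λ n → tt , (s ,_) , refl , tt ,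
    (λ i _ → Edge⇒Rb (e s i) (refl , refl , refl)) , (λ _ _ → refl)

  -- A walk witnessing `ψ` starts at height 0, is kept on the path `s` by `R2` and climbs one node
  -- per edge. Its edge number `i` thus leaves `(s , i)`, where the label is `e s i`.
  Ω-path : ∀ {η} → Ω pathStr η → ∃ λ s → ∀ i → η i ≡ e s i
  -- Length `suc i` is the least at which `ψ` constrains `η i`.
  Ω-path {η} ((s , k) , realises) = s , λ i → agree i (realises (suc i))
    where
    agree : ∀ i → ψ pathStr (suc i) η (s , k) → η i ≡ e s i
    agree i (_ , y , start , _ , edge , below) = sym
      (trans (sym (cong₂ e (below i (<⇒≤ ≤-refl)) (height i (<⇒≤ ≤-refl))))
             (proj₂ (proj₂ (Rb⇒Edge (η i) (edge i ≤-refl)))))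
      where
      height : ∀ j → j ≤ suc i → proj₂ (y j) ≡ j
      height zero    _   = start
      height (suc j) j<n = trans (proj₁ (proj₂ (Rb⇒Edge (η j) (edge j j<n))))
                                 (cong suc (height j (<⇒≤ j<n)))

-- The covering family is indexed by finite strings to fit a dense family with one point per string.
CountableModel : Σ¹₁ → Set₁
CountableModel φ = Σ Str λ 𝓜 → 𝓜 ⊨ φ ×
  Σ (List Bool → 2^ω) λ e → ∀ η → Ω 𝓜 η → ∃ λ s → ∀ i → η i ≡ e s i

theorem15 : ExcludedMiddle (lsuc 0ℓ) →
    Σ (ℕ → 2^ω) (λ A₀ →
    (A : 2^ω → Set) → Extensional A →
    ((n : ℕ) → A (A₀ n)) →
    Dense (λ η → ¬ A η) →
    ¬ Σ Σ¹₁ (λ φ → (𝓜 : Str) → ((𝓜 ⊨ φ → K A 𝓜) × (K A 𝓜 → 𝓜 ⊨ φ))))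
theorem15 em = point ∘ enum , undefinable
  where
  codeIndex : Σ¹₁ × List Bool → ℕ
  codeIndex (φ , s) = pair (codeSentence φ) (codeList codeBool s)

  codeIndex-injective : Injective _≡_ _≡_ codeIndex
  codeIndex-injective = pair-cong-injective _,_ codeSentence-injective
    (codeList-injective codeBool-injective)

  enumeration : Σ (ℕ → Σ¹₁ × List Bool) (StrictlySurjective _≡_)
  enumeration = enumerate em (record { arities = [] ; body = fals } , []) codeIndex-injective

  enum : ℕ → Σ¹₁ × List Bool
  enum = proj₁ enumeration

  -- Excluded middle for the Σ-type CountableModel φ doubles as choice: the model
  -- it returns depends on φ only, not on s.
  point : Σ¹₁ × List Bool → 2^ω
  point (φ , s) with em {CountableModel φ}
  ... | yes (_ , _ , e , _) = e s
  -- A filler value: such a `φ` has no model to be defeated.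
  ... | no _                = λ _ → false

  undefinable : (A : 2^ω → Set) → Extensional A → (∀ n → A (point (enum n))) →
    Dense (λ η → ¬ A η) →
    ¬ Σ Σ¹₁ (λ φ → (𝓜 : Str) → ((𝓜 ⊨ φ → K A 𝓜) × (K A 𝓜 → 𝓜 ⊨ φ)))
  undefinable A A-ext A₀⊆A dense (φ , defines) = absurd
    where
    -- The countable dense set outside `A`: one point through each finite string.
    e : List Bool → 2^ω
    e s = proj₁ (dense s)

    pathStr∈K : K A (pathStr e)
    pathStr∈K s = e s , proj₁ (proj₂ (dense s)) , path-Ω e s , proj₂ (proj₂ (dense s))

    point∈A : ∀ s → A (point (φ , s))
    point∈A s with proj₂ enumeration (φ , s)
    ... | n , h = subst (A ∘ point) h (A₀⊆A n)

    absurd : _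
    -- Abstracting `point∈A` along with the decision lets `point (φ , s)` in its type reduce to
    -- `e′ s`, for the very model that is returned.
    absurd with em {CountableModel φ} | point∈A
    ... | no ∄ | _ =
      ∄ (pathStr e , proj₂ (defines (pathStr e)) pathStr∈K , e , λ _ → Ω-path e)
    -- Density at the empty string gives a point of `Ω 𝓜` outside `A`.
    ... | yes (𝓜 , 𝓜⊨φ , e′ , covers) | e′∈A with proj₁ (defines 𝓜) 𝓜⊨φ []
    ...   | η , _ , η∈Ω , η∉A with covers η η∈Ω
    -- The cover agrees with `η` only pointwise; extensionality of `A` bridges the gap.
    ...     | s , η≐ = η∉A (A-ext (e′ s) η (sym ∘ η≐) (e′∈A s))
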